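{- Let $q$ be an odd prime power, $n$ a positive integer, and $f(x,y,z,t)=xy+z+t$ viewed as a function from $M_n(\mathbb{F}_q)^4$ to $M_n(\mathbb{F}_q)$. There is a constant $C_0>0$ (independent of $q$ and $A$) such that for every $A\subset M_n(\mathbb{F}_q)$ with $|A|\ge C_0\, q^{n^2-1/4}$ we have $f(A,A,A,A)=M_n(\mathbb{F}_q)$, i.e. every matrix $M\in M_n(\mathbb{F}_q)$ can be written as $a_1a_2+a_3+a_4$ with $a_1,a_2,a_3,a_4\in A$.
   Context: $M_n(\mathbb{F}_q)$ is the ring of $n\times n$ matrices over $\mathbb{F}_q$. -}

module Defs where

open import Data.Nat using (ℕ; zero; suc; _^_)
open import Data.Fin using (Fin; zero; suc)
open import Data.Product using (∃; _×_)
open import Data.Nat.Primality using (Prime)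
open import Data.Nat.Divisibility using (_∣_)
open import Relation.Nullary using (¬_)
open import Relation.Binary.PropositionalEquality using (_≡_)
import Algebra.Structures as S

-- A finite field with exactly q elements, represented with carrier Fin q
-- (every field of order q is isomorphic to one of this form).
record FiniteField (q : ℕ) : Set where
  infixl 6 _+_
  infixl 7 _*_
  field
    _+_ _*_ : Fin q → Fin q → Fin q
    -_      : Fin q → Fin q
    0# 1#   : Fin q
    isCommutativeRing : S.IsCommutativeRing _≡_ _+_ _*_ -_ 0# 1#
    0≢1     : ¬ (0# ≡ 1#)
    inverse : ∀ x → ¬ (x ≡ 0#) → ∃ λ y → x * y ≡ 1#

Mat : ℕ → ℕ → Set
Mat q n = Fin n → Fin n → Fin q

module MatOps {q : ℕ} (F : FiniteField q) where
  open FiniteField F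

  sumF : ∀ n → (Fin n → Fin q) → Fin q
  sumF zero    f = 0#
  sumF (suc n) f = f zero + sumF n (λ k → f (suc k))

  _⊕_ : ∀ {n} → Mat q n → Mat q n → Mat q n
  (a ⊕ b) i j = a i j + b i j

  _⊗_ : ∀ {n} → Mat q n → Mat q n → Mat q n
  _⊗_ {n} a b i j = sumF n (λ k → a i k * b k j)

_≋_ : ∀ {q n} → Mat q n → Mat q n → Set
a ≋ b = ∀ i j → a i j ≡ b i j

OddPrimePower : ℕ → Set
OddPrimePower q = ∃ λ p → ∃ λ k → Prime p × (q ≡ p ^ suc k) × ¬ (2 ∣ q)

{-# OPTIONS --safe #-}

-- A second moment argument. Put N = q^(n²), s = |A|, and let deg(y,w) count the pairs (x,z) ∈ A²
-- with xy + z = w; its mean over all (y,w) is s²/N. Summing deg² counts the coincidences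
-- xy + z = x′y + z′. For fixed z, z′ at most one y works if x − x′ is invertible, while the
-- singular matrices number at most n q^(n²−1), since in each of them some column is a combination
-- of the others. Hence the variance Σ (deg − s²/N)² is at most n s² N² / q. If M is not represented,
-- then deg vanishes on the s² pairs of A × (M − A), so the variance is at least s⁶/N², and therefore
-- s⁴ ≤ n N⁴/q.

module Submission where

open import Defs
open import Data.Nat using (ℕ; _*_; _^_; _∸_; _≤_)
open import Data.Product using (∃; _×_)
open import Data.List using (List; length)
open import Data.List.Membership.Propositional using (_∈_)
open import Data.List.Relation.Unary.AllPairs using (AllPairs)
open import Relation.Nullary using (¬_)

open import Algebra.Bundles using (CommutativeRing)
import Algebra.Properties.Group as GroupProperties
import Algebra.Properties.Ring as RingProperties
import Algebra.Properties.Semiring.Sum as SemiringSum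
open import Data.Bool using (if_then_else_)
open import Data.Empty using (⊥-elim)
open import Data.Fin using (Fin; zero; suc; punchIn; combine; remQuot; funToFin; finToFun)
open import Data.Fin.Properties
  using (_≟_; any?; all?; suc-injective; remQuot-combine; finToFun-funToFin; funToFin-finToFin)
open import Data.List using (lookup; _∷_)
open import Data.List.Membership.Propositional.Properties using (∈-lookup)
import Data.List.Relation.Unary.All as All
open import Data.List.Relation.Unary.AllPairs using (_∷_)
open import Data.Nat using (zero; suc; _<_; z≤n; s≤s; NonZero)
import Data.Nat.Properties as ℕ
open import Data.Nat.Tactic.RingSolver using (solve-∀)
open import Data.Product using (_,_)
open import Data.Sum using (_⊎_; inj₁; inj₂)
open import Data.Vec.Functional using (Vector; insertAt; removeAt; tail)
open import Function using (_∘_)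
open import Function.Definitions using (Injective)
open import Level using (0ℓ)
open import Relation.Binary.PropositionalEquality
open import Relation.Nullary using (Dec; yes; no; does)
open import Relation.Nullary.Decidable using (_×-dec_; ¬?)

-- Finite sums and indicators in `ℕ`.

module Counting where

  open import Data.Nat using (_+_)
  open import Data.Nat.Properties hiding (_≟_; suc-injective)
  open SemiringSum +-*-semiring public
    using (sum; sum-syntax; sum-cong-≗; ∑-comm; ∑-distrib-+; *-distribˡ-sum; *-distribʳ-sum)

  ∑-mono-≤ : ∀ {n} {f g : Fin n → ℕ} → (∀ i → f i ≤ g i) → sum f ≤ sum g
  ∑-mono-≤ {zero}  f≤g = z≤n
  ∑-mono-≤ {suc n} f≤g = +-mono-≤ (f≤g zero) (∑-mono-≤ (f≤g ∘ suc))

  ∑-const : ∀ n c → ∑[ i < n ] c ≡ n * c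
  ∑-const zero    c = refl
  ∑-const (suc n) c = cong (c +_) (∑-const n c)

  ∑-bound : ∀ {n c} {f : Fin n → ℕ} → (∀ i → f i ≤ c) → sum f ≤ n * c
  ∑-bound {n} {c} f≤c = ≤-trans (∑-mono-≤ f≤c) (≤-reflexive (∑-const n c))

  ∑-zero : ∀ {n} {f : Fin n → ℕ} → (∀ i → f i ≡ 0) → sum f ≡ 0
  ∑-zero {n} f≡0 = trans (sum-cong-≗ f≡0) (trans (∑-const n 0) (*-zeroʳ n))

  𝟙 : ∀ {P : Set} → Dec P → ℕ
  𝟙 P? = if does P? then 1 else 0

  𝟙-yes : ∀ {P : Set} (P? : Dec P) → P → 𝟙 P? ≡ 1
  𝟙-yes (yes _) p = refl
  𝟙-yes (no ¬p) p = ⊥-elim (¬p p)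

  𝟙-no : ∀ {P : Set} (P? : Dec P) → ¬ P → 𝟙 P? ≡ 0
  𝟙-no (yes p) ¬p = ⊥-elim (¬p p)
  𝟙-no (no _)  ¬p = refl

  ∑-𝟙≤1 : ∀ {n} {P : Fin n → Set} (P? : ∀ i → Dec (P i)) →
          (∀ i j → P i → P j → i ≡ j) → ∑[ i < n ] 𝟙 (P? i) ≤ 1
  ∑-𝟙≤1 {zero}  P? unique = z≤n
  ∑-𝟙≤1 {suc n} P? unique with P? zero
  ... | yes p = ≤-reflexive (cong suc (∑-zero λ i → 𝟙-no (P? (suc i)) λ q → 0≢suc (unique _ _ p q)))
    where
    0≢suc : ∀ {i : Fin n} → ¬ (zero ≡ suc i)
    0≢suc ()
  ... | no _  = ∑-𝟙≤1 (P? ∘ suc) λ i j p q → suc-injective (unique _ _ p q)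

  ∑-sift : ∀ {n} (a : Fin n) (φ : Fin n → ℕ) → ∑[ w < n ] (𝟙 (a ≟ w) * φ w) ≡ φ a
  ∑-sift {suc n} zero φ = trans (cong₂ _+_ (*-identityˡ (φ zero)) (∑-zero {n} λ i → refl)) (+-identityʳ _)
  ∑-sift {suc n} (suc a) φ = ∑-sift a (φ ∘ suc)

  ∑-𝟙 : ∀ {n} (a : Fin n) → ∑[ w < n ] 𝟙 (a ≟ w) ≡ 1
  ∑-𝟙 {n} a = trans (sum-cong-≗ {n} λ w → sym (*-identityʳ _)) (∑-sift a (λ _ → 1))

  -- Double counting of the pairs (i, k) with `e i ≡ L k`: each i satisfying `P` lies in at least
  -- one pair, and by injectivity of `e` each k lies in at most one. `L` may repeat values or miss
  -- the image of `e`, so a redundant parametrisation is enough to bound a count.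
  ∑-covered : ∀ {s c N} {P : Fin s → Set} (P? : ∀ i → Dec (P i)) (e : Fin s → Fin N) (L : Fin c → Fin N) →
              Injective _≡_ _≡_ e → (∀ i → P i → ∃ λ k → L k ≡ e i) → ∑[ i < s ] 𝟙 (P? i) ≤ c
  ∑-covered {s} {c} P? e L e-inj cover = begin
    ∑[ i < s ] 𝟙 (P? i)                     ≤⟨ ∑-mono-≤ covered ⟩
    ∑[ i < s ] ∑[ k < c ] 𝟙 (e i ≟ L k)     ≡⟨ ∑-comm {s} {c} _ ⟩
    ∑[ k < c ] ∑[ i < s ] 𝟙 (e i ≟ L k)     ≤⟨ ∑-bound (λ k → ∑-𝟙≤1 (λ i → e i ≟ L k) λ i j p q → e-inj (trans p (sym q))) ⟩
    c * 1                                   ≡⟨ *-identityʳ c ⟩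
    c                                       ∎
    where
    open ≤-Reasoning
    covered : ∀ i → 𝟙 (P? i) ≤ ∑[ k < c ] 𝟙 (e i ≟ L k)
    covered i with P? i
    ... | no _  = z≤n
    ... | yes p with k , eq ← cover i p = begin
      1                                    ≡⟨ ∑-𝟙 k ⟨
      ∑[ k′ < c ] 𝟙 (k ≟ k′)               ≤⟨ ∑-mono-≤ (λ k′ → below k′ (k ≟ k′)) ⟩
      ∑[ k′ < c ] 𝟙 (e i ≟ L k′)           ∎
      where
      below : ∀ k′ (k≟k′ : Dec (k ≡ k′)) → 𝟙 k≟k′ ≤ 𝟙 (e i ≟ L k′)
      below k′ (yes refl) = ≤-reflexive (sym (𝟙-yes (e i ≟ L k) (sym eq)))
      below k′ (no _)     = z≤n

  -- Nonnegativity of (a - b)² without subtraction: the larger number is written as the smaller plus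
  -- k, and the two sides then differ by k².
  am-gm : ∀ a b → 2 * a * b ≤ a * a + b * b
  am-gm a b with ≤-total a b
  ... | inj₁ a≤b = subst (λ b → 2 * a * b ≤ a * a + b * b) (m+[n∸m]≡n a≤b) (go a (b ∸ a))
    where
    identity : ∀ a k → a * a + (a + k) * (a + k) ≡ 2 * a * (a + k) + k * k
    identity = solve-∀
    go : ∀ a k → 2 * a * (a + k) ≤ a * a + (a + k) * (a + k)
    go a k = ≤-trans (m≤m+n _ (k * k)) (≤-reflexive (sym (identity a k)))
  ... | inj₂ b≤a = subst (λ a → 2 * a * b ≤ a * a + b * b) (m+[n∸m]≡n b≤a) (go b (a ∸ b))
    where
    identity : ∀ b k → (b + k) * (b + k) + b * b ≡ 2 * (b + k) * b + k * k
    identity = solve-∀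
    go : ∀ b k → 2 * (b + k) * b ≤ (b + k) * (b + k) + b * b
    go b k = ≤-trans (m≤m+n _ (k * k)) (≤-reflexive (sym (identity b k)))

  -- The second moment argument for an abstract family of maps.

  module SecondMoment {s N c : ℕ}
    (f : Fin s → Fin N → Fin s → Fin N)
    (f-injective : ∀ i y → Injective _≡_ _≡_ (f i y))
    {Bad : Fin s → Fin s → Set} (Bad? : ∀ i i′ → Dec (Bad i i′))
    (bad-few : ∀ i → ∑[ i′ < s ] 𝟙 (Bad? i i′) ≤ c)
    (good-unique : ∀ i i′ → ¬ Bad i i′ → ∀ k k′ y y′ → f i y k ≡ f i′ y k′ → f i y′ k ≡ f i′ y′ k′ → y ≡ y′)
    where

    -- In the application `f i y k` is the code of xᵢy + xₖ, where i and k are positions in A and y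
    -- runs over the codes of all N matrices; `Bad i i′` means that xᵢ - xᵢ′ is singular.
    deg : Fin N → Fin N → ℕ
    deg y w = ∑[ i < s ] ∑[ k < s ] 𝟙 (f i y k ≟ w)

    -- Moving the sum over w innermost lets the indicator select w = `f i y k`. The choice φ = 1
    -- gives the first moment, φ = `deg y` the second.
    deg-sift : ∀ y (φ : Fin N → ℕ) → ∑[ w < N ] (deg y w * φ w) ≡ ∑[ i < s ] ∑[ k < s ] φ (f i y k)
    deg-sift y φ = begin
      ∑[ w < N ] (deg y w * φ w)
        ≡⟨ sum-cong-≗ (λ w → trans (*-distribʳ-sum {s} (φ w) _) (sum-cong-≗ {s} λ i → *-distribʳ-sum {s} (φ w) _)) ⟩
      ∑[ w < N ] ∑[ i < s ] ∑[ k < s ] (𝟙 (f i y k ≟ w) * φ w)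
        ≡⟨ ∑-comm {N} {s} _ ⟩
      ∑[ i < s ] ∑[ w < N ] ∑[ k < s ] (𝟙 (f i y k ≟ w) * φ w)
        ≡⟨ sum-cong-≗ {s} (λ i → ∑-comm {N} {s} _) ⟩
      ∑[ i < s ] ∑[ k < s ] ∑[ w < N ] (𝟙 (f i y k ≟ w) * φ w)
        ≡⟨ sum-cong-≗ {s} (λ i → sum-cong-≗ {s} λ k → ∑-sift (f i y k) φ) ⟩
      ∑[ i < s ] ∑[ k < s ] φ (f i y k) ∎
      where open ≡-Reasoning

    ∑-deg : ∑[ y < N ] ∑[ w < N ] deg y w ≡ N * (s * s)
    ∑-deg = begin
      ∑[ y < N ] ∑[ w < N ] deg y w        ≡⟨ sum-cong-≗ {N} (λ y → trans (sum-cong-≗ {N} λ w → sym (*-identityʳ (deg y w))) (deg-sift y _)) ⟩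
      ∑[ y < N ] ∑[ i < s ] ∑[ k < s ] 1   ≡⟨ sum-cong-≗ {N} (λ y → sum-cong-≗ {s} λ i → trans (∑-const s 1) (*-identityʳ s)) ⟩
      ∑[ y < N ] ∑[ i < s ] s              ≡⟨ sum-cong-≗ {N} (λ y → ∑-const s s) ⟩
      ∑[ y < N ] (s * s)                   ≡⟨ ∑-const N (s * s) ⟩
      N * (s * s)                          ∎
      where open ≡-Reasoning

    collisions : Fin s → Fin s → ℕ
    collisions i i′ = ∑[ y < N ] ∑[ k < s ] ∑[ k′ < s ] 𝟙 (f i′ y k′ ≟ f i y k)

    -- For a bad pair, y and k are free and injectivity of `f i′ y` leaves at most one k′, giving N
    -- s. For a good pair, k and k′ are free and leave at most one y, giving s². Adding the two
    -- bounds makes the result summable over i′ by means of `bad-few`.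
    collisions-≤ : ∀ i i′ → collisions i i′ ≤ s * s + 𝟙 (Bad? i i′) * (N * s)
    collisions-≤ i i′ with Bad? i i′
    ... | yes _ = begin
      collisions i i′          ≤⟨ ∑-bound (λ y → ∑-bound λ k → ∑-𝟙≤1 (λ k′ → f i′ y k′ ≟ f i y k)
                                    λ _ _ p q → f-injective i′ y (trans p (sym q))) ⟩
      N * (s * 1)              ≡⟨ cong (N *_) (*-identityʳ s) ⟩
      N * s                    ≤⟨ m≤n+m _ (s * s) ⟩
      s * s + N * s            ≡⟨ cong (s * s +_) (*-identityˡ (N * s)) ⟨
      s * s + 1 * (N * s)      ∎
      where open ≤-Reasoning
    ... | no good = begin
      collisions i i′          ≡⟨ ∑-comm {N} {s} _ ⟩
      ∑[ k < s ] ∑[ y < N ] ∑[ k′ < s ] 𝟙 (f i′ y k′ ≟ f i y k)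
                               ≡⟨ sum-cong-≗ {s} (λ k → ∑-comm {N} {s} _) ⟩
      ∑[ k < s ] ∑[ k′ < s ] ∑[ y < N ] 𝟙 (f i′ y k′ ≟ f i y k)
                               ≤⟨ ∑-bound (λ k → ∑-bound λ k′ → ∑-𝟙≤1 (λ y → f i′ y k′ ≟ f i y k)
                                    λ y y′ p q → good-unique i i′ good k k′ y y′ (sym p) (sym q)) ⟩
      s * (s * 1)              ≡⟨ cong (s *_) (*-identityʳ s) ⟩
      s * s                    ≡⟨ +-identityʳ (s * s) ⟨
      s * s + 0                ∎
      where open ≤-Reasoning

    -- The term s⁴ is what a constant `deg` equal to s²/N would contribute; the excess c N s² comes
    -- from the bad pairs.
    ∑-deg² : ∑[ y < N ] ∑[ w < N ] (deg y w * deg y w) ≤ s * (s * (s * s) + c * (N * s))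
    ∑-deg² = begin
      ∑[ y < N ] ∑[ w < N ] (deg y w * deg y w)
        ≡⟨ sum-cong-≗ {N} (λ y → deg-sift y (deg y)) ⟩
      ∑[ y < N ] ∑[ i < s ] ∑[ k < s ] deg y (f i y k)
        ≡⟨ ∑-comm {N} {s} _ ⟩
      ∑[ i < s ] ∑[ y < N ] ∑[ k < s ] deg y (f i y k)
        -- Unfolding `deg y (f i y k)` exposes sums over i′ and k′; i′ is moved outwards past k and
        -- then past y.
        ≡⟨ sum-cong-≗ {s} (λ i → trans (sum-cong-≗ {N} λ y → ∑-comm {s} {s} _) (∑-comm {N} {s} _)) ⟩
      ∑[ i < s ] ∑[ i′ < s ] collisions i i′
        ≤⟨ ∑-bound (λ i → row i) ⟩
      s * (s * (s * s) + c * (N * s)) ∎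
      where
      open ≤-Reasoning
      row : ∀ i → ∑[ i′ < s ] collisions i i′ ≤ s * (s * s) + c * (N * s)
      row i = begin
        ∑[ i′ < s ] collisions i i′
          ≤⟨ ∑-mono-≤ (collisions-≤ i) ⟩
        ∑[ i′ < s ] (s * s + 𝟙 (Bad? i i′) * (N * s))
          ≡⟨ ∑-distrib-+ {s} _ _ ⟩
        ∑[ i′ < s ] (s * s) + ∑[ i′ < s ] (𝟙 (Bad? i i′) * (N * s))
          ≡⟨ cong₂ _+_ (∑-const s (s * s)) (sym (*-distribʳ-sum {s} (N * s) _)) ⟩
        s * (s * s) + (∑[ i′ < s ] 𝟙 (Bad? i i′)) * (N * s)
          ≤⟨ +-monoʳ-≤ (s * (s * s)) (*-monoˡ-≤ (N * s) (bad-few i)) ⟩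
        s * (s * s) + c * (N * s) ∎

    module _ (e g : Fin s → Fin N) (e-inj : Injective _≡_ _≡_ e) (g-inj : Injective _≡_ _≡_ g) where

      -- `e` is to list the codes of A and `g` those of M - A, so a solution reads xᵢxⱼ + xₖ = M -
      -- xₗ.
      Solution : Set
      Solution = ∃ λ i → ∃ λ j → ∃ λ k → ∃ λ l → f i (e j) k ≡ g l

      solution? : Dec Solution
      solution? = any? λ i → any? λ j → any? λ k → any? λ l → f i (e j) k ≟ g l

      -- For injective `h` this is the indicator function of the image of `h`; in the form of a sum,
      -- its total follows by exchanging summations.
      multiplicity : (Fin s → Fin N) → Fin N → ℕ
      multiplicity h y = ∑[ j < s ] 𝟙 (h j ≟ y)

      multiplicity≤1 : ∀ h → Injective _≡_ _≡_ h → ∀ y → multiplicity h y ≤ 1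
      multiplicity≤1 h h-inj y = ∑-𝟙≤1 (λ j → h j ≟ y) λ i j p q → h-inj (trans p (sym q))

      ∑-multiplicity : ∀ h → ∑[ y < N ] multiplicity h y ≡ s
      ∑-multiplicity h = trans (∑-comm {N} {s} _)
        (trans (sum-cong-≗ {s} λ j → ∑-𝟙 (h j)) (trans (∑-const s 1) (*-identityʳ s)))

      target : Fin N → Fin N → ℕ
      target y w = multiplicity e y * multiplicity g w

      ∑-target : ∑[ y < N ] ∑[ w < N ] target y w ≡ s * s
      ∑-target = begin
        ∑[ y < N ] ∑[ w < N ] target y w   ≡⟨ sum-cong-≗ {N} (λ y → *-distribˡ-sum {N} (multiplicity e y) _) ⟨
        ∑[ y < N ] (multiplicity e y * ∑[ w < N ] multiplicity g w)
                                           ≡⟨ *-distribʳ-sum {N} _ (multiplicity e) ⟨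
        (∑[ y < N ] multiplicity e y) * ∑[ w < N ] multiplicity g w
                                           ≡⟨ cong₂ _*_ (∑-multiplicity e) (∑-multiplicity g) ⟩
        s * s                              ∎
        where open ≡-Reasoning

      multiplicity≡0 : ∀ h y → ¬ (∃ λ j → h j ≡ y) → multiplicity h y ≡ 0
      multiplicity≡0 h y none = ∑-zero λ j → 𝟙-no (h j ≟ y) λ p → none (j , p)

      -- Outside A × (M - A) the factor of `target` that fails vanishes. At y = `e j` and w = `g l`,
      -- any nonzero term of `deg y w` would be a solution.
      disjoint : ¬ Solution → ∀ y w → deg y w ≡ 0 ⊎ target y w ≡ 0
      disjoint none y w with any? (λ j → e j ≟ y) | any? (λ l → g l ≟ w)
      ... | no ∄j | _ = inj₂ (cong (_* multiplicity g w) (multiplicity≡0 e y ∄j))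
      ... | _ | no ∄l = inj₂ (trans (cong (multiplicity e y *_) (multiplicity≡0 g w ∄l)) (*-zeroʳ (multiplicity e y)))
      ... | yes (j , refl) | yes (l , refl) =
        inj₁ (∑-zero λ i → ∑-zero λ k → 𝟙-no (f i (e j) k ≟ g l) λ p → none (i , j , k , l , p))

      s⁴ : ℕ
      s⁴ = s * s * (s * s)

      -- N² · (deg − s²/N)² ≥ s⁴ · target, with the cross term moved to the left.
      deviation : ¬ Solution → ∀ y w →
        2 * N * (s * s) * deg y w + s⁴ * target y w ≤ N * N * (deg y w * deg y w) + s⁴
      deviation none y w with disjoint none y w
      ... | inj₁ d≡0 rewrite d≡0 = begin
        2 * N * (s * s) * 0 + s⁴ * target y w  ≡⟨ cong (_+ s⁴ * target y w) (*-zeroʳ (2 * N * (s * s))) ⟩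
        s⁴ * target y w                        ≤⟨ *-monoʳ-≤ s⁴ (*-mono-≤ (multiplicity≤1 e e-inj y) (multiplicity≤1 g g-inj w)) ⟩
        s⁴ * 1                                 ≡⟨ *-identityʳ s⁴ ⟩
        s⁴                                     ≤⟨ m≤n+m s⁴ _ ⟩
        N * N * (0 * 0) + s⁴                   ∎
        where open ≤-Reasoning
      ... | inj₂ t≡0 rewrite t≡0 = begin
        2 * N * (s * s) * d + s⁴ * 0           ≡⟨ lhs N s d ⟩
        2 * (N * d) * (s * s)                     ≤⟨ am-gm (N * d) (s * s) ⟩
        N * d * (N * d) + s * s * (s * s)         ≡⟨ rhs N s d ⟩
        N * N * (d * d) + s⁴                   ∎
        where
        open ≤-Reasoning
        d = deg y w
        lhs : ∀ N s d → 2 * N * (s * s) * d + s * s * (s * s) * 0 ≡ 2 * (N * d) * (s * s)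
        lhs = solve-∀
        rhs : ∀ N s d → N * d * (N * d) + s * s * (s * s) ≡ N * N * (d * d) + s * s * (s * s)
        rhs = solve-∀

      total-deviation : ¬ Solution →
        2 * N * (s * s) * (N * (s * s)) + s⁴ * (s * s) ≤
        N * N * (s * (s * (s * s) + c * (N * s))) + N * (N * s⁴)
      total-deviation none = begin
        2 * N * (s * s) * (N * (s * s)) + s⁴ * (s * s)
          ≡⟨ cong₂ (λ a b → 2 * N * (s * s) * a + s⁴ * b) ∑-deg ∑-target ⟨
        2 * N * (s * s) * (∑[ y < N ] ∑[ w < N ] deg y w) + s⁴ * (∑[ y < N ] ∑[ w < N ] target y w)
          ≡⟨ cong₂ _+_ (∑∑-* (2 * N * (s * s)) deg) (∑∑-* s⁴ target) ⟩
        ∑[ y < N ] ∑[ w < N ] (2 * N * (s * s) * deg y w) + ∑[ y < N ] ∑[ w < N ] (s⁴ * target y w)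
          ≡⟨ ∑∑-+ _ _ ⟨
        ∑[ y < N ] ∑[ w < N ] (2 * N * (s * s) * deg y w + s⁴ * target y w)
          ≤⟨ ∑-mono-≤ (λ y → ∑-mono-≤ (deviation none y)) ⟩
        ∑[ y < N ] ∑[ w < N ] (N * N * (deg y w * deg y w) + s⁴)
          ≡⟨ ∑∑-+ _ _ ⟩
        ∑[ y < N ] ∑[ w < N ] (N * N * (deg y w * deg y w)) + ∑[ y < N ] ∑[ w < N ] s⁴
          ≡⟨ cong₂ _+_ (sym (∑∑-* (N * N) (λ y w → deg y w * deg y w)))
                       (trans (sum-cong-≗ {N} λ y → ∑-const N s⁴) (∑-const N (N * s⁴))) ⟩
        N * N * (∑[ y < N ] ∑[ w < N ] (deg y w * deg y w)) + N * (N * s⁴)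
          ≤⟨ +-monoˡ-≤ (N * (N * s⁴)) (*-monoʳ-≤ (N * N) ∑-deg²) ⟩
        N * N * (s * (s * (s * s) + c * (N * s))) + N * (N * s⁴) ∎
        where
        open ≤-Reasoning
        ∑∑-* : ∀ a (φ : Fin N → Fin N → ℕ) → a * (∑[ y < N ] ∑[ w < N ] φ y w) ≡ ∑[ y < N ] ∑[ w < N ] (a * φ y w)
        ∑∑-* a φ = trans (*-distribˡ-sum {N} a _) (sum-cong-≗ {N} λ y → *-distribˡ-sum {N} a (φ y))
        ∑∑-+ : ∀ (φ ψ : Fin N → Fin N → ℕ) →
               ∑[ y < N ] ∑[ w < N ] (φ y w + ψ y w) ≡ ∑[ y < N ] ∑[ w < N ] φ y w + ∑[ y < N ] ∑[ w < N ] ψ y w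
        ∑∑-+ φ ψ = trans (sum-cong-≗ {N} λ y → ∑-distrib-+ {N} (φ y) (ψ y)) (∑-distrib-+ {N} _ _)

      -- Without a solution, both sides of `total-deviation` contain 2N²s⁴; cancelling it leaves s⁶
      -- ≤ c N³ s², which contradicts the hypothesis multiplied by s².
      solvable : c * (N * N * N) < s⁴ → Solution
      solvable large with solution?
      ... | yes sol = sol
      ... | no none = ⊥-elim (<⇒≱ (*-monoˡ-< (s * s) {{s²≢0 s large}} large) upper)
        where
        s²≢0 : ∀ s {b} → b < s * s * (s * s) → NonZero (s * s)
        s²≢0 (suc s) _ = _
        lhs : ∀ N s → 2 * N * (s * s) * (N * (s * s)) + s * s * (s * s) * (s * s)
                      ≡ 2 * N * N * (s * s * (s * s)) + s * s * (s * s) * (s * s)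
        lhs = solve-∀
        rhs : ∀ N s c → N * N * (s * (s * (s * s) + c * (N * s))) + N * (N * (s * s * (s * s)))
                        ≡ 2 * N * N * (s * s * (s * s)) + c * (N * N * N) * (s * s)
        rhs = solve-∀
        upper : s⁴ * (s * s) ≤ c * (N * N * N) * (s * s)
        upper = +-cancelˡ-≤ (2 * N * N * s⁴) _ _
          (≤-trans (≤-reflexive (sym (lhs N s))) (≤-trans (total-deviation none) (≤-reflexive (rhs N s c))))

-- Coding matrices by elements of a finite set.

funToFin-cong : ∀ {m n} {f g : Fin m → Fin n} → f ≗ g → funToFin f ≡ funToFin g
funToFin-cong {zero}  f≗g = refl
funToFin-cong {suc m} f≗g = cong₂ combine (f≗g zero) (funToFin-cong (f≗g ∘ suc))

insertAt-unique : ∀ {A : Set} {n} {xs : Vector A n} {v} {ys : Vector A (suc n)} (j : Fin (suc n)) →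
                  xs ≗ removeAt ys j → v ≡ ys j → insertAt xs j v ≗ ys
insertAt-unique {n = n}     zero    xs≗ v≡ zero    = v≡
insertAt-unique {n = n}     zero    xs≗ v≡ (suc k) = xs≗ k
insertAt-unique {n = suc n} (suc j) xs≗ v≡ zero    = xs≗ zero
insertAt-unique {n = suc n} {ys = ys} (suc j) xs≗ v≡ (suc k) = insertAt-unique {ys = tail ys} j (xs≗ ∘ suc) v≡ k

-- The rows are coded first and then the vector of row codes, whence the size `(q ^ c) ^ r`.
-- Rectangular shapes are allowed because the parameter arrays of singular matrices are coded as
-- well.
encode : ∀ {q r c} → (Fin r → Fin c → Fin q) → Fin ((q ^ c) ^ r)
encode a = funToFin (λ i → funToFin (a i))

decode : ∀ {q r c} → Fin ((q ^ c) ^ r) → Fin r → Fin c → Fin q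
decode k i = finToFun (finToFun k i)

decode-encode : ∀ {q r c} (a : Fin r → Fin c → Fin q) i j → decode (encode a) i j ≡ a i j
decode-encode a i j =
  trans (cong (λ k → finToFun k j) (finToFun-funToFin (λ i → funToFin (a i)) i)) (finToFun-funToFin (a i) j)

encode-cong : ∀ {q r c} {a b : Fin r → Fin c → Fin q} → (∀ i j → a i j ≡ b i j) → encode a ≡ encode b
encode-cong a≋b = funToFin-cong (λ i → funToFin-cong (a≋b i))

encode-injective : ∀ {q r c} (a b : Fin r → Fin c → Fin q) → encode a ≡ encode b → ∀ i j → a i j ≡ b i j
encode-injective a b eq i j =
  trans (sym (decode-encode a i j)) (trans (cong (λ k → decode k i j) eq) (decode-encode b i j))

decode-injective : ∀ {q r c} {k l : Fin ((q ^ c) ^ r)} →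
                   (∀ i j → decode {q} {r} {c} k i j ≡ decode l i j) → k ≡ l
decode-injective {q} {r} {c} {k} {l} k≋l = trans (sym (code k)) (trans (encode-cong k≋l) (code l))
  where
  code : ∀ k → encode {q} {r} {c} (decode k) ≡ k
  code k = trans (funToFin-cong {r} λ i → funToFin-finToFin {c} (finToFun {q ^ c} {r} k i)) (funToFin-finToFin {r} k)

lookup-distinct : ∀ {q n} {A : List (Mat q n)} → AllPairs (λ a b → ¬ (a ≋ b)) A →
                  ∀ {i j} → lookup A i ≋ lookup A j → i ≡ j
lookup-distinct (_ ∷ _)   {zero}  {zero}  _  = refl
lookup-distinct {A = _ ∷ A} (a≉ ∷ _)  {zero}  {suc j} eq = ⊥-elim (All.lookup a≉ (∈-lookup {xs = A} j) eq)
lookup-distinct {A = _ ∷ A} (a≉ ∷ _)  {suc i} {zero}  eq = ⊥-elim (All.lookup a≉ (∈-lookup {xs = A} i) λ r c → sym (eq r c))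
lookup-distinct (_ ∷ A≉)  {suc i} {suc j} eq = cong suc (lookup-distinct A≉ eq)

-- Linear algebra over the field and singular differences.

module Matrices {q : ℕ} (F : FiniteField q) where

  open FiniteField F using (isCommutativeRing; inverse)
  open MatOps F

  commutativeRing : CommutativeRing 0ℓ 0ℓ
  commutativeRing = record { isCommutativeRing = isCommutativeRing }

  module R = CommutativeRing commutativeRing
  open R using (_+_; _-_; -_; 0#; 1#) renaming (_*_ to _·_)
  open GroupProperties R.+-group
    using (//-rightDividesˡ; //-rightDividesʳ; ⁻¹-anti-homo-∙; ⁻¹-anti-homo-//; ⁻¹-injective; ∙-cancelˡ;
           x∙y⁻¹≈ε⇒x≈y; x≈y⇒x∙y⁻¹≈ε; inverseˡ-unique)
  open RingProperties R.ring using (-‿distribˡ-*; -‿distribʳ-*; x[y-z]≈xy-xz; [y-z]x≈yx-zx)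
  open SemiringSum R.semiring using (sum; sum-cong-≗; sum-remove; ∑-distrib-+; *-distribʳ-sum)
  open ≡-Reasoning

  sumF≡sum : ∀ n (f : Fin n → Fin q) → sumF n f ≡ sum f
  sumF≡sum zero    f = refl
  sumF≡sum (suc n) f = cong (f zero +_) (sumF≡sum n (f ∘ suc))

  sumF-cong : ∀ {n} {f g : Fin n → Fin q} → f ≗ g → sumF n f ≡ sumF n g
  sumF-cong {zero}  f≗g = refl
  sumF-cong {suc n} f≗g = cong₂ _+_ (f≗g zero) (sumF-cong (f≗g ∘ suc))

  sum-sub : ∀ {n} (f g : Fin n → Fin q) → sum (λ i → f i - g i) ≡ sum f - sum g
  sum-sub {n} f g = begin
    sum (λ i → f i - g i)                     ≡⟨ //-rightDividesʳ (sum g) (sum (λ i → f i - g i)) ⟨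
    sum (λ i → f i - g i) + sum g - sum g     ≡⟨ cong (_- sum g) (∑-distrib-+ {n} _ g) ⟨
    sum (λ i → (f i - g i) + g i) - sum g     ≡⟨ cong (_- sum g) (sum-cong-≗ {n} λ i → //-rightDividesˡ (g i) (f i)) ⟩
    sum f - sum g                             ∎

  x-[x-y]≡y : ∀ x y → x - (x - y) ≡ y
  x-[x-y]≡y x y = trans (cong (x +_) (⁻¹-anti-homo-// x y)) (trans (R.+-comm x (y - x)) (//-rightDividesˡ x y))

  [x+z]-[y+z]≡x-y : ∀ x y z → (x + z) - (y + z) ≡ x - y
  [x+z]-[y+z]≡x-y x y z = begin
    (x + z) - (y + z)          ≡⟨ cong (x + z +_) (⁻¹-anti-homo-∙ y z) ⟩
    (x + z) + (- z + - y)      ≡⟨ R.+-assoc (x + z) (- z) (- y) ⟨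
    (x + z) - z - y            ≡⟨ cong (_- y) (//-rightDividesʳ z x) ⟩
    x - y                      ∎

  x-y≢0 : ∀ {x y} → ¬ (x ≡ y) → ¬ (x - y ≡ 0#)
  x-y≢0 x≢y eq = x≢y (x∙y⁻¹≈ε⇒x≈y _ _ eq)

  _·ᵛ_ : ∀ {n} → Mat q n → (Fin n → Fin q) → Fin n → Fin q
  (a ·ᵛ v) r = sum (λ k → a r k · v k)

  ·ᵛ-cong : ∀ {n} (a : Mat q n) {v w} → v ≗ w → ∀ r → (a ·ᵛ v) r ≡ (a ·ᵛ w) r
  ·ᵛ-cong {n} a v≗w r = sum-cong-≗ {n} λ k → cong (a r k ·_) (v≗w k)

  _⊖_ : ∀ {n} → Mat q n → Mat q n → Mat q n
  (a ⊖ b) r k = a r k - b r k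

  ⊗-cong : ∀ {n} (a : Mat q n) {b c} → b ≋ c → (a ⊗ b) ≋ (a ⊗ c)
  ⊗-cong a b≋c r p = sumF-cong λ k → cong (a r k ·_) (b≋c k p)

  ⊗-sub : ∀ {n} (a b c : Mat q n) r p → (a ·ᵛ (λ k → b k p - c k p)) r ≡ (a ⊗ b) r p - (a ⊗ c) r p
  ⊗-sub {n} a b c r p = begin
    sum (λ k → a r k · (b k p - c k p))
      ≡⟨ sum-cong-≗ {n} (λ k → x[y-z]≈xy-xz (a r k) (b k p) (c k p)) ⟩
    sum (λ k → a r k · b k p - a r k · c k p)
      ≡⟨ sum-sub {n} _ _ ⟩
    sum (λ k → a r k · b k p) - sum (λ k → a r k · c k p)
      ≡⟨ cong₂ _-_ (sumF≡sum n _) (sumF≡sum n _) ⟨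
    (a ⊗ b) r p - (a ⊗ c) r p ∎

  -- x and x′ are bad when x − x′ is singular.
  Bad : ∀ {n} → Mat q n → Mat q n → Set
  Bad {n} x x′ = ∃ λ (v : Fin (q ^ n)) →
    (∃ λ (j : Fin n) → ¬ (finToFun v j ≡ 0#)) × (∀ r → (x ·ᵛ finToFun v) r ≡ (x′ ·ᵛ finToFun v) r)

  -- The vector is quantified through its code in `Fin (q ^ n)`, so exhaustive search decides.
  Bad? : ∀ {n} (x x′ : Mat q n) → Dec (Bad x x′)
  Bad? x x′ = any? λ v → any? (λ j → ¬? (finToFun v j ≟ 0#)) ×-dec all? λ r → (x ·ᵛ finToFun v) r ≟ (x′ ·ᵛ finToFun v) r

  -- Subtracting the two equations cancels z and z′ and leaves (x - x′)(y - y′) = 0. If y and y′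
  -- differ at the entry (b, p), column p of y - y′ is a nonzero vector killed by x - x′.
  good-cancel : ∀ {n} (x x′ z z′ y y′ : Mat q n) → ¬ Bad x x′ →
                ((x ⊗ y) ⊕ z) ≋ ((x′ ⊗ y) ⊕ z′) → ((x ⊗ y′) ⊕ z) ≋ ((x′ ⊗ y′) ⊕ z′) → y ≋ y′
  good-cancel x x′ z z′ y y′ good eq eq′ b p with y b p ≟ y′ b p
  ... | yes same = same
  ... | no differ = ⊥-elim (good (funToFin v , (b , λ v≡0 → x-y≢0 differ (trans (sym (v-code b)) v≡0)) , λ r → begin
    (x ·ᵛ finToFun (funToFin v)) r                          ≡⟨ ·ᵛ-cong x v-code r ⟩
    (x ·ᵛ v) r                                              ≡⟨ ⊗-sub x y y′ r p ⟩
    (x ⊗ y) r p - (x ⊗ y′) r p                              ≡⟨ [x+z]-[y+z]≡x-y _ _ (z r p) ⟨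
    ((x ⊗ y) r p + z r p) - ((x ⊗ y′) r p + z r p)          ≡⟨ cong₂ _-_ (eq r p) (eq′ r p) ⟩
    ((x′ ⊗ y) r p + z′ r p) - ((x′ ⊗ y′) r p + z′ r p)      ≡⟨ [x+z]-[y+z]≡x-y _ _ (z′ r p) ⟩
    (x′ ⊗ y) r p - (x′ ⊗ y′) r p                            ≡⟨ ⊗-sub x′ y y′ r p ⟨
    (x′ ·ᵛ v) r                                             ≡⟨ ·ᵛ-cong x′ v-code r ⟨
    (x′ ·ᵛ finToFun (funToFin v)) r                         ∎))
    where
    v = λ k → y k p - y′ k p
    v-code = finToFun-funToFin v

  -- Row 0 of E holds the coefficients expressing column j through the other columns;
  -- row suc r of E is row r of the matrix with its entry in column j deleted.
  singular : ∀ {m} → Fin (suc m) → (Fin (suc (suc m)) → Fin m → Fin q) → Mat q (suc m)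
  singular j E r = insertAt (E (suc r)) j (sum (λ l → E zero l · E (suc r) l))

  -- Dividing D v = 0 by `v j` expresses column j through the other columns with coefficients -
  -- vₗ/vⱼ, which form row 0 of E. Every E′ agreeing entrywise with E is covered, because decoding a
  -- code recovers an array only entrywise.
  singular-surjective : ∀ {m} (D : Mat q (suc m)) (v : Fin (suc m) → Fin q) j → ¬ (v j ≡ 0#) →
                        (∀ r → (D ·ᵛ v) r ≡ 0#) →
                        ∃ λ E → ∀ E′ → (∀ a b → E′ a b ≡ E a b) → singular j E′ ≋ D
  singular-surjective {m} D v j vj≢0 Dv≡0 with u , vj·u≡1 ← inverse (v j) vj≢0 = E , λ E′ E′≋E r →
    insertAt-unique j (E′≋E (suc r))
      (trans (sum-cong-≗ {m} λ l → cong₂ _·_ (E′≋E zero l) (E′≋E (suc r) l)) (dependent r))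
    where
    E : Fin (suc (suc m)) → Fin m → Fin q
    E zero    l = v (punchIn j l) · - u
    E (suc r) l = D r (punchIn j l)
    dependent : ∀ r → sum (λ l → E zero l · E (suc r) l) ≡ D r j
    dependent r = begin
      sum (λ l → (v (punchIn j l) · - u) · D r (punchIn j l))
        ≡⟨ sum-cong-≗ {m} (λ l → trans (R.*-comm _ _) (sym (R.*-assoc (D r (punchIn j l)) _ (- u)))) ⟩
      sum (λ l → (D r (punchIn j l) · v (punchIn j l)) · - u)
        ≡⟨ *-distribʳ-sum {m} (- u) _ ⟨
      S · - u                   ≡⟨ -‿distribʳ-* S u ⟨
      - (S · u)                 ≡⟨ -‿distribˡ-* S u ⟩
      - S · u                   ≡⟨ cong (_· u) (inverseˡ-unique (D r j · v j) S
                                     (trans (sym (sum-remove {m} {j} (λ k → D r k · v k))) (Dv≡0 r))) ⟨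
      (D r j · v j) · u         ≡⟨ R.*-assoc _ _ _ ⟩
      D r j · (v j · u)         ≡⟨ cong (D r j ·_) vj·u≡1 ⟩
      D r j · 1#                ≡⟨ R.*-identityʳ _ ⟩
      D r j                     ∎
      where S = sum (λ l → D r (punchIn j l) · v (punchIn j l))

  -- Counting bad partners and applying the second moment argument.

  module _ {m : ℕ} where

    -- `Q` counts the arrays E for one choice of column. Its exponent of q is m(n + 1) = n² - 1, so
    -- `n * Q` bounds the number of singular matrices.
    n Q : ℕ
    n = suc m
    Q = (q ^ m) ^ suc n

    singularCode : Fin n × Fin Q → Mat q n
    singularCode (j , k) = singular j (decode k)

    badPartner : Mat q n → Fin (n * Q) → Mat q n
    badPartner x k = x ⊖ singularCode (remQuot Q k)

    -- The singular matrix x - x′ equals `singular j E` for some j and E, and x′ is recovered as x -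
    -- (x - x′).
    bad-covered : ∀ x x′ → Bad x x′ → ∃ λ k → badPartner x k ≋ x′
    bad-covered x x′ (v , (j , vj≢0) , xv≡x′v)
      with E , surj ← singular-surjective (x ⊖ x′) (finToFun v) j vj≢0 (λ r →
             trans (sum-cong-≗ {n} λ k → [y-z]x≈yx-zx (finToFun v k) (x r k) (x′ r k))
             (trans (sum-sub {n} (λ k → x r k · finToFun v k) (λ k → x′ r k · finToFun v k)) (x≈y⇒x∙y⁻¹≈ε (xv≡x′v r))))
      = combine j (encode E) , λ r k → trans (cong (λ d → x r k - d) (partner r k)) (x-[x-y]≡y (x r k) (x′ r k))
      where
      partner : singularCode (remQuot Q (combine j (encode E))) ≋ (x ⊖ x′)
      partner = subst (λ jk → singularCode jk ≋ (x ⊖ x′)) (sym (remQuot-combine j (encode E)))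
        (surj (decode (encode E)) (decode-encode E))

    represent : (A : List (Mat q n)) → AllPairs (λ a b → ¬ (a ≋ b)) A →
                (let N = (q ^ n) ^ n in n * Q * (N * N * N) < length A * length A * (length A * length A)) →
                (M : Mat q n) →
                ∃ λ a₁ → ∃ λ a₂ → ∃ λ a₃ → ∃ λ a₄ →
                a₁ ∈ A × a₂ ∈ A × a₃ ∈ A × a₄ ∈ A × ((((a₁ ⊗ a₂) ⊕ a₃) ⊕ a₄) ≋ M)
    represent A distinct large M =
      let i , j , k , l , eq = solvable e g e-injective g-injective large
      in x i , x j , x k , x l , ∈-lookup i , ∈-lookup j , ∈-lookup k , ∈-lookup l , λ r p → begin
        ((x i ⊗ x j) r p + x k r p) + x l r p
          ≡⟨ cong (λ s → (s + x k r p) + x l r p) (⊗-cong (x i) (decode-encode (x j)) r p) ⟨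
        ((x i ⊗ decode (e j)) r p + x k r p) + x l r p
          ≡⟨ cong (_+ x l r p) (encode-injective ((x i ⊗ decode (e j)) ⊕ x k) (M ⊖ x l) eq r p) ⟩
        (M r p - x l r p) + x l r p
          ≡⟨ //-rightDividesˡ (x l r p) (M r p) ⟩
        M r p ∎
      where
      x = lookup A
      e g : Fin (length A) → Fin ((q ^ n) ^ n)
      e j = encode (x j)
      g l = encode (M ⊖ x l)
      e-injective : Injective _≡_ _≡_ e
      e-injective eq = lookup-distinct distinct (encode-injective _ _ eq)
      g-injective : Injective _≡_ _≡_ g
      g-injective {l} {l′} eq = lookup-distinct distinct λ r p →
        ⁻¹-injective (∙-cancelˡ (M r p) _ _ (encode-injective (M ⊖ x l) (M ⊖ x l′) eq r p))
      f : Fin (length A) → Fin ((q ^ n) ^ n) → Fin (length A) → Fin ((q ^ n) ^ n)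
      f i y k = encode ((x i ⊗ decode y) ⊕ x k)
      f-injective : ∀ i y → Injective _≡_ _≡_ (f i y)
      f-injective i y {k} {k′} eq = lookup-distinct distinct λ r p → ∙-cancelˡ ((x i ⊗ decode y) r p) _ _
        (encode-injective ((x i ⊗ decode y) ⊕ x k) ((x i ⊗ decode y) ⊕ x k′) eq r p)
      bad? : ∀ i i′ → Dec (Bad (x i) (x i′))
      bad? i i′ = Bad? (x i) (x i′)
      bad-few : ∀ i → Counting.sum (λ i′ → Counting.𝟙 (bad? i i′)) ≤ n * Q
      -- Different positions of A carry different matrices, so the bad partners of xᵢ inside A are
      -- no more numerous than the indices of `badPartner`.
      bad-few i = Counting.∑-covered (bad? i) e (λ k → encode (badPartner (x i) k)) e-injective
        λ i′ bad → let k , eq = bad-covered (x i) (x i′) bad in k , encode-cong eq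
      good-unique : ∀ i i′ → ¬ Bad (x i) (x i′) → ∀ k k′ y y′ →
                    f i y k ≡ f i′ y k′ → f i y′ k ≡ f i′ y′ k′ → y ≡ y′
      good-unique i i′ good k k′ y y′ eq eq′ = decode-injective
        (good-cancel (x i) (x i′) (x k) (x k′) (decode y) (decode y′) good
          (encode-injective _ _ eq) (encode-injective _ _ eq′))
      open Counting.SecondMoment f f-injective bad? bad-few good-unique using (solvable)

-- The exponent of the threshold and the constant.

threshold-exponent : ∀ q m → (let n = suc m; N = (q ^ n) ^ n in
  (q ^ m) ^ suc n * (N * N * N) ≡ q ^ (4 * (n * n) ∸ 1))
threshold-exponent q m = begin
  (q ^ m) ^ suc n * (N * N * N)
    ≡⟨ cong₂ (λ a b → a * (b * b * b)) (ℕ.^-*-assoc q m (suc n)) (ℕ.^-*-assoc q n n) ⟩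
  q ^ (m * suc n) * (q ^ (n * n) * q ^ (n * n) * q ^ (n * n))
    ≡⟨ cong (λ b → q ^ (m * suc n) * (b * q ^ (n * n))) (ℕ.^-distribˡ-+-* q (n * n) (n * n)) ⟨
  q ^ (m * suc n) * (q ^ (n * n + n * n) * q ^ (n * n))
    ≡⟨ cong (q ^ (m * suc n) *_) (ℕ.^-distribˡ-+-* q (n * n + n * n) (n * n)) ⟨
  q ^ (m * suc n) * q ^ (n * n + n * n + n * n)
    ≡⟨ ℕ.^-distribˡ-+-* q (m * suc n) (n * n + n * n + n * n) ⟨
  q ^ (m * suc n + (n * n + n * n + n * n))
    -- This is m(n + 1) + 3n² = 4n² - 1. In `exponent` one is added to both sides, so that the
    -- truncated subtraction acts on a successor.
    ≡⟨ cong (λ k → q ^ (k ∸ 1)) (exponent m) ⟩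
  q ^ (4 * (n * n) ∸ 1) ∎
  where
  open import Data.Nat using (_+_)
  open ≡-Reasoning
  n N : ℕ
  n = suc m
  N = (q ^ n) ^ n
  exponent : ∀ m → let n = suc m in suc (m * suc n + (n * n + n * n + n * n)) ≡ 4 * (n * n)
  exponent = solve-∀

nonZero : ∀ {q} → Fin q → NonZero q
nonZero {suc _} _ = _

-- The bound |A| ≥ C₀ q^(n² - 1/4) enters through its fourth power, so K stands for C₀⁴ and all
-- exponents are natural numbers. K is chosen after n but before q, F and A.
theorem1p11 : (n : ℕ) → 1 ≤ n →
    ∃ λ (K : ℕ) → 1 ≤ K ×
    ((q : ℕ) → OddPrimePower q → (F : FiniteField q) →
    (A : List (Mat q n)) → AllPairs (λ a b → ¬ (a ≋ b)) A →
    K * q ^ (4 * (n * n) ∸ 1) ≤ length A ^ 4 →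
    (M : Mat q n) →
    ∃ λ a₁ → ∃ λ a₂ → ∃ λ a₃ → ∃ λ a₄ →
    a₁ ∈ A × a₂ ∈ A × a₃ ∈ A × a₄ ∈ A ×
    (MatOps._⊕_ F (MatOps._⊕_ F (MatOps._⊗_ F a₁ a₂) a₃) a₄ ≋ M))
-- Taking K = n + 1 rather than n leaves room for one positive term q^(4n² - 1), which gives the
-- strict inequality that `represent` asks for.
theorem1p11 (suc m) _ = suc n , s≤s z≤n , λ q _ F A distinct large M →
  Matrices.represent F A distinct (dense q F (length A) large) M
  where
  n = suc m
  fourth : ∀ s → s ^ 4 ≡ s * s * (s * s)
  fourth s = trans (ℕ.^-distribˡ-+-* s 2 2) (cong (λ t → t * t) (cong (s *_) (ℕ.*-identityʳ s)))
  dense : ∀ q → FiniteField q → ∀ s → suc n * q ^ (4 * (n * n) ∸ 1) ≤ s ^ 4 →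
          (let N = (q ^ n) ^ n in n * (q ^ m) ^ suc n * (N * N * N) < s * s * (s * s))
  dense q F s large = begin-strict
    n * (q ^ m) ^ suc n * (N * N * N)     ≡⟨ ℕ.*-assoc n ((q ^ m) ^ suc n) (N * N * N) ⟩
    n * ((q ^ m) ^ suc n * (N * N * N))   ≡⟨ cong (n *_) (threshold-exponent q m) ⟩
    n * T                                 <⟨ ℕ.m<n+m (n * T) (ℕ.m^n>0 q {{nonZero (FiniteField.0# F)}} (4 * (n * n) ∸ 1)) ⟩
    suc n * T                             ≤⟨ large ⟩
    s ^ 4                                 ≡⟨ fourth s ⟩
    s * s * (s * s)                       ∎
    where
    open ℕ.≤-Reasoning
    N = (q ^ n) ^ n
    T = q ^ (4 * (n * n) ∸ 1)
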